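{- Let $G$ be a finite graph containing an induced copy of the two-edge path $P=(s,t,v)$ (with $s,v$ the endpoints and $t$ the middle vertex). If $G$ has no induced cycle of length $5$, or if every vertex of $G$ has degree at most $3$, then $G$ contains an avoidable copy of the two-rooted graph $(P,s,t)$.
   Context: All graphs are finite, simple and undirected. A two-rooted graph is a triple $(H,s,t)$ where $H$ is a graph and $s,t\in V(H)$. A copy of a two-rooted graph $(\hat H,\hat s,\hat t)$ in a graph $G$ is a two-rooted graph $(H,s,t)$ such that $H$ is an induced subgraph of $G$ and some isomorphism $\hat H\to H$ maps $\hat s\mapsto s$, $\hat t\mapsto t$. An extension of a copy $(H,s,t)$ in $G$ is a two-rooted graph $(H',s',t')$ with $H'$ an induced subgraph of $G$, $V(H')=V(H)\cup\{s',t'\}$, $s'\neq t'$, $s',t'\notin V(H)$, $H'-\{s',t'\}=H$, and $s$ (resp. $t$) the unique neighbour of $s'$ (resp. $t'$) in $H'$. The extension is closable if there is an induced $s',t'$-path in $G$ all of whose internal vertices lie outside $N_G[V(H)]$. A copy is avoidable if all its extensions in $G$ are closable. -}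

module Defs where

open import Data.Nat using (ℕ; zero; suc; _<_; _≤_; _+_)
open import Data.Bool using (Bool; true; false)
open import Data.Fin using (Fin; toℕ; fromℕ)
open import Data.List using (List; length; filterᵇ; allFin)
open import Data.Product using (Σ; ∃; _×_; _,_)
open import Data.Sum using (_⊎_)
open import Relation.Nullary using (¬_)
open import Relation.Binary.PropositionalEquality using (_≡_; _≢_)
open import Function.Definitions using (Injective)

record Graph : Set where
  field
    n      : ℕ
    adj    : Fin n → Fin n → Bool
    sym    : ∀ u v → adj u v ≡ adj v u
    irrefl : ∀ v → adj v v ≡ false

module _ (G : Graph) where
  open Graph G

  V : Set
  V = Fin n

  _~_ : V → V → Set
  u ~ v = adj u v ≡ true

  degree : V → ℕ
  degree v = length (filterᵇ (adj v) (allFin n))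

  InClosedNbhd : V → V → V → V → Set
  InClosedNbhd a b c x =
    (x ≡ a ⊎ x ≡ b ⊎ x ≡ c) ⊎ (x ~ a ⊎ x ~ b ⊎ x ~ c)

  HasInducedC5 : Set
  HasInducedC5 = Σ V λ v0 → Σ V λ v1 → Σ V λ v2 → Σ V λ v3 → Σ V λ v4 →
      (v0 ≢ v1 × v0 ≢ v2 × v0 ≢ v3 × v0 ≢ v4 × v1 ≢ v2 × v1 ≢ v3 × v1 ≢ v4 ×
       v2 ≢ v3 × v2 ≢ v4 × v3 ≢ v4)
    × (v0 ~ v1 × v1 ~ v2 × v2 ~ v3 × v3 ~ v4 × v4 ~ v0)
    × (¬ v0 ~ v2 × ¬ v0 ~ v3 × ¬ v1 ~ v3 × ¬ v1 ~ v4 × ¬ v2 ~ v4)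

  -- (a , b , c) induces a copy of the path P = s–t–v, i.e. G[{a,b,c}] ≅ P
  -- via s ↦ a, t ↦ b, v ↦ c.  The corresponding copy of (P,s,t) is
  -- (G[{a,b,c}], a, b).
  IsP3Copy : V → V → V → Set
  IsP3Copy a b c = a ≢ b × b ≢ c × a ≢ c × a ~ b × b ~ c × ¬ a ~ c

  -- (H', s', t') is an extension of the copy (G[{a,b,c}], a, b):
  -- s' ≠ t', both outside {a,b,c}, and in H' = G[{a,b,c,s',t'}] the unique
  -- neighbour of s' is a and the unique neighbour of t' is b.
  IsExtension : V → V → V → V → V → Set
  IsExtension a b c s' t' =
      s' ≢ t'
    × (s' ≢ a × s' ≢ b × s' ≢ c) × (t' ≢ a × t' ≢ b × t' ≢ c)
    × (s' ~ a × ¬ s' ~ b × ¬ s' ~ c × ¬ s' ~ t')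
    × (t' ~ b × ¬ t' ~ a × ¬ t' ~ c)

  IsInducedPath : (k : ℕ) → (Fin (suc k) → V) → Set
  IsInducedPath k p =
      Injective _≡_ _≡_ p
    × (∀ i j → (p i ~ p j) → (suc (toℕ i) ≡ toℕ j ⊎ suc (toℕ j) ≡ toℕ i))
    × (∀ i j → suc (toℕ i) ≡ toℕ j → p i ~ p j)

  Closable : V → V → V → V → V → Set
  Closable a b c s' t' =
    Σ ℕ λ k → Σ (Fin (suc k) → V) λ p →
        IsInducedPath k p
      × p Fin.zero ≡ s'
      × p (fromℕ k) ≡ t'
      × (∀ i → 0 < toℕ i → toℕ i < k → ¬ InClosedNbhd a b c (p i))

  Avoidable : V → V → V → Set
  Avoidable a b c = ∀ s' t' → IsExtension a b c s' t' → Closable a b c s' t'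

-- Work inside induced subgraphs G[S], by induction on S.  If some u ∈ S lies
-- outside the closed neighbourhood of some copy, grow {u} to a connected set U
-- such that R = S ∖ N[U] still contains a copy and every vertex of the boundary
-- N(U) has a neighbour on every copy in R (otherwise absorb it into U).  Two
-- boundary vertices are always linked through U, and an extension with s' on the
-- boundary and t' in R is impossible, because s' would miss the copy (t', b, c).
-- Let (a, b, c) be avoidable in G[R].  If it is not avoidable in G[S], there is
-- an extension (s', x) with s' ∈ R, x ∈ N(U) and no common neighbour of s' and x
-- in R outside N[a, b, c].  Then (s', a, b) is avoidable, unless it has an
-- extension (w, z) with w ∈ R; as x has a neighbour on (w, s', a), the vertices
-- x, w, s', a, b induce a 5-cycle.  If all degrees are at most 3, this
-- determines the graph around that cycle, and s' is left with the two
-- neighbours a and w, so that (a, s', w) has no extension at all.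
module Submission where

open import Defs
open import Data.Nat using (ℕ; zero; suc; _≤_; _<_; s≤s; z≤n)
import Data.Nat.Properties as ℕ
open import Data.Bool using (true)
import Data.Bool.Properties as Bool
open import Data.Fin using (Fin; zero; suc; toℕ; fromℕ)
open import Data.Fin.Properties using (_≟_; any?; suc-injective; toℕ-fromℕ; injective⇒≤)
open import Data.Fin.Subset using (Subset; _∈_; _∉_; _⊆_; _⊂_; _⊃_; _∪_; ⁅_⁆; ⊤)
open import Data.Fin.Subset.Properties using (_∈?_; x∈⁅x⁆; x∈⁅y⁆⇒x≡y; x∈p∪q⁻; x∈p∪q⁺; p⊆p∪q; ∈⊤)
open import Data.Fin.Subset.Induction using (Acc; acc; ⊂-wellFounded; ⊃-wellFounded)
open import Data.List using (List; []; _∷_; length; lookup)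
open import Data.List.Membership.Propositional using () renaming (_∈_ to _∈ˡ_)
open import Data.List.Membership.Propositional.Properties using (∈-filter⁺; ∈-allFin; ∈-lookup)
open import Data.List.Relation.Unary.All as All using (All; []; _∷_)
open import Data.List.Relation.Unary.AllPairs using ([]; _∷_)
open import Data.List.Relation.Unary.Any using (index)
open import Data.List.Relation.Unary.Any.Properties using (lookup-index)
open import Data.List.Relation.Unary.Unique.Propositional using (Unique)
open import Data.Product using (Σ; ∃; ∃-syntax; _×_; _,_; proj₁; proj₂)
open import Data.Sum using (_⊎_; inj₁; inj₂; [_,_])
import Data.Sum as Sum
open import Data.Empty using (⊥; ⊥-elim)
import Data.Vec as Vec
import Data.Vec.Functional as Vector
open import Data.Vec.Properties using ([]=⇒lookup; lookup⇒[]=; lookup∘tabulate)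
open import Function using (_∘_)
open import Function.Bundles using (Equivalence)
open import Function.Definitions using (Injective)
open import Relation.Nullary using (¬_; Dec; yes; no; does; contradiction)
open import Relation.Nullary.Decidable using (¬?; _×-dec_; _⊎-dec_; decidable-stable; dec-true)
open import Relation.Unary using (Decidable)
open import Relation.Binary.PropositionalEquality using (_≡_; _≢_; refl; sym; trans; cong; subst)

-- Counting distinct list entries; subsets cut out by decidable predicates

lookup-injective : ∀ {A : Set} {xs : List A} → Unique xs → Injective _≡_ _≡_ (lookup xs)
lookup-injective (_ ∷ _)  {zero}  {zero}  _  = refl
lookup-injective (x∉ ∷ _) {zero}  {suc j} eq = contradiction eq (All.lookup x∉ (∈-lookup j))
lookup-injective (x∉ ∷ _) {suc i} {zero}  eq = contradiction (sym eq) (All.lookup x∉ (∈-lookup i))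
lookup-injective (_ ∷ u)  {suc i} {suc j} eq = cong suc (lookup-injective u eq)

unique-⊆⇒length≤ : ∀ {A : Set} {xs ys : List A} → Unique xs → All (_∈ˡ ys) xs → length xs ≤ length ys
unique-⊆⇒length≤ {xs = xs} {ys} u xs⊆ys = injective⇒≤ {f = position} position-injective
  where
  member : ∀ i → lookup xs i ∈ˡ ys
  member i = All.lookup xs⊆ys (∈-lookup i)

  position : Fin (length xs) → Fin (length ys)
  position = index ∘ member

  position-injective : Injective _≡_ _≡_ position
  position-injective {i} {j} eq = lookup-injective u
    (trans (lookup-index (member i)) (trans (cong (lookup ys) eq) (sym (lookup-index (member j)))))

module _ {n : ℕ} {P : Fin n → Set} (P? : Decidable P) where

  comprehension : Subset n
  comprehension = Vec.tabulate (does ∘ P?)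

  ∈-comprehension⁺ : ∀ {x} → P x → x ∈ comprehension
  ∈-comprehension⁺ {x} px = lookup⇒[]= x _ (trans (lookup∘tabulate _ x) (dec-true (P? x) px))

  ∈-comprehension⁻ : ∀ {x} → x ∈ comprehension → P x
  ∈-comprehension⁻ {x} x∈ with P? x | trans (sym (lookup∘tabulate (does ∘ P?) x)) ([]=⇒lookup x∈)
  ... | yes px | _ = px
  ... | no _   | ()

-- Adjacency, degrees and decidability of the basic notions

module _ (G : Graph) where
  open Graph G using (n; adj; irrefl) renaming (sym to adj-sym)

  infix 4 _—_ _—?_

  _—_ : Fin n → Fin n → Set
  _—_ = _~_ G

  _—?_ : ∀ u v → Dec (u — v)
  u —? v = adj u v Bool.≟ true

  —-sym : ∀ {u v} → u — v → v — u
  —-sym {u} {v} u—v = trans (adj-sym v u) u—v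

  —⇒≢ : ∀ {u v} → u — v → u ≢ v
  —⇒≢ {u} u—u refl with trans (sym u—u) (irrefl u)
  ... | ()

  separated : ∀ {u v w} → u — w → ¬ v — w → u ≢ v
  separated u—w v≁w refl = v≁w u—w

  unique-neighbours : ∀ {v us} → Unique us → All (v —_) us → length us ≤ degree G v
  unique-neighbours {v} u v—us = unique-⊆⇒length≤ u
    (All.map (λ {x} v—x → ∈-filter⁺ (Bool.T? ∘ adj v) (∈-allFin x) (Equivalence.from Bool.T-≡ v—x)) v—us)

  ¬four-neighbours : ∀ {v p q r s} → degree G v ≤ 3 → v — p → v — q → v — r → v — s →
    p ≢ q → p ≢ r → p ≢ s → q ≢ r → q ≢ s → r ≢ s → ⊥
  ¬four-neighbours d≤3 vp vq vr vs p≢q p≢r p≢s q≢r q≢s r≢s = ℕ.<-irrefl refl (ℕ.≤-trans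
    (unique-neighbours
      ((p≢q ∷ p≢r ∷ p≢s ∷ []) ∷ (q≢r ∷ q≢s ∷ []) ∷ (r≢s ∷ []) ∷ [] ∷ [])
      (vp ∷ vq ∷ vr ∷ vs ∷ []))
    d≤3)

  p3 : ∀ {a b c} → a — b → b — c → a ≢ c → ¬ a — c → IsP3Copy G a b c
  p3 a—b b—c a≢c a≁c = —⇒≢ a—b , —⇒≢ b—c , a≢c , a—b , b—c , a≁c

  isP3Copy? : ∀ a b c → Dec (IsP3Copy G a b c)
  isP3Copy? a b c = ¬? (a ≟ b) ×-dec ¬? (b ≟ c) ×-dec ¬? (a ≟ c) ×-dec (a —? b) ×-dec (b —? c) ×-dec ¬? (a —? c)

  inClosedNbhd? : ∀ a b c x → Dec (InClosedNbhd G a b c x)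
  inClosedNbhd? a b c x =
    ((x ≟ a) ⊎-dec (x ≟ b) ⊎-dec (x ≟ c)) ⊎-dec ((x —? a) ⊎-dec (x —? b) ⊎-dec (x —? c))

  isExtension? : ∀ a b c s t → Dec (IsExtension G a b c s t)
  isExtension? a b c s t =
    ¬? (s ≟ t)
    ×-dec (¬? (s ≟ a) ×-dec ¬? (s ≟ b) ×-dec ¬? (s ≟ c))
    ×-dec (¬? (t ≟ a) ×-dec ¬? (t ≟ b) ×-dec ¬? (t ≟ c))
    ×-dec ((s —? a) ×-dec ¬? (s —? b) ×-dec ¬? (s —? c) ×-dec ¬? (s —? t))
    ×-dec ((t —? b) ×-dec ¬? (t —? a) ×-dec ¬? (t —? c))

  -- Walks from walks to induced paths

  -- Walks whose internal vertices satisfy T.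
  data Linked (T : Fin n → Set) : Fin n → Fin n → Set where
    edge : ∀ {u v} → u — v → Linked T u v
    via  : ∀ {u w v} → u — w → T w → Linked T w v → Linked T u v

  linked-map : ∀ {T T′ : Fin n → Set} → (∀ {x} → T x → T′ x) → ∀ {u v} → Linked T u v → Linked T′ u v
  linked-map f (edge u—v)      = edge u—v
  linked-map f (via u—w tw wv) = via u—w (f tw) (linked-map f wv)

  linked-snoc : ∀ {T : Fin n → Set} {u w v} → Linked T u w → T w → w — v → Linked T u v
  linked-snoc (edge u—w)      tw w—v = via u—w tw (edge w—v)
  linked-snoc (via u—x tx xw) tw w—v = via u—x tx (linked-snoc xw tw w—v)

  -- The first vertex is exempt from `Q`: the start of a walk need not satisfy the condition imposed
  -- on the later vertices.
  InducedPathFrom : (Q : Fin n → Set) → Fin n → Fin n → Set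
  InducedPathFrom Q u t = Σ ℕ λ k → Σ (Fin (suc k) → Fin n) λ p →
    IsInducedPath G k p × p zero ≡ u × p (fromℕ k) ≡ t × (∀ i → 0 < toℕ i → Q (p i))

  tail-induced : ∀ {k p} → IsInducedPath G (suc k) p → IsInducedPath G k (p ∘ suc)
  tail-induced (inj , only , all) =
      (λ eq → suc-injective (inj eq))
    , (λ i j e → Sum.map ℕ.suc-injective ℕ.suc-injective (only (suc i) (suc j) e))
    , (λ i j e → all (suc i) (suc j) (cong suc e))

  -- Equality is included because a walk may return to its start; the path is then cut at that
  -- vertex instead of prolonged.
  Meets : Fin n → Fin n → Set
  Meets u v = u ≡ v ⊎ u — v

  meets? : ∀ u v → Dec (Meets u v)
  meets? u v = (u ≟ v) ⊎-dec (u —? v)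

  cons-induced : ∀ {k p u} → IsInducedPath G k p → u — p zero → (∀ i → 0 < toℕ i → ¬ Meets u (p i)) →
    IsInducedPath G (suc k) (u Vector.∷ p)
  cons-induced {k} {p} {u} (inj , only , all) u—p₀ far = inj′ , only′ , all′
    where
    u≢p : ∀ i → u ≢ p i
    u≢p zero    = —⇒≢ u—p₀
    u≢p (suc i) = far (suc i) (s≤s z≤n) ∘ inj₁

    q : Fin (suc (suc k)) → Fin n
    q = u Vector.∷ p

    inj′ : Injective _≡_ _≡_ q
    inj′ {zero}  {zero}  _  = refl
    inj′ {zero}  {suc j} eq = contradiction eq (u≢p j)
    inj′ {suc i} {zero}  eq = contradiction (sym eq) (u≢p i)
    inj′ {suc i} {suc j} eq = cong suc (inj eq)

    only′ : ∀ i j → q i — q j → suc (toℕ i) ≡ toℕ j ⊎ suc (toℕ j) ≡ toℕ i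
    only′ zero          zero          e = contradiction refl (—⇒≢ e)
    only′ zero          (suc zero)    e = inj₁ refl
    only′ zero          (suc (suc j)) e = contradiction (inj₂ e) (far (suc j) (s≤s z≤n))
    only′ (suc zero)    zero          e = inj₂ refl
    only′ (suc (suc i)) zero          e = contradiction (inj₂ (—-sym e)) (far (suc i) (s≤s z≤n))
    only′ (suc i)       (suc j)       e = Sum.map (cong suc) (cong suc) (only i j e)

    all′ : ∀ i j → suc (toℕ i) ≡ toℕ j → q i — q j
    all′ zero    (suc zero) _ = u—p₀
    all′ (suc i) (suc j)    e = all i j (ℕ.suc-injective e)

  -- The new path enters p at the last vertex that u meets.
  attach : ∀ Q {u t} k (p : Fin (suc k) → Fin n) → IsInducedPath G k p → p (fromℕ k) ≡ t →
    (∀ i → Q (p i)) → ∃ (λ i → Meets u (p i)) → InducedPathFrom Q u t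
  attach Q {u} {t} k p ind end q (i , m) = go k p ind end q i m
    where
    enter : ∀ k (p : Fin (suc k) → Fin n) → IsInducedPath G k p → p (fromℕ k) ≡ t →
      (∀ i → Q (p i)) → (∀ i → 0 < toℕ i → ¬ Meets u (p i)) → Meets u (p zero) → InducedPathFrom Q u t
    enter k p ind end q far (inj₁ u≡p₀) = k , p , ind , sym u≡p₀ , end , λ i _ → q i
    enter k p ind end q far (inj₂ u—p₀) =
      suc k , u Vector.∷ p , cons-induced ind u—p₀ far , refl , end , λ { (suc i) _ → q i }

    go : ∀ k (p : Fin (suc k) → Fin n) → IsInducedPath G k p → p (fromℕ k) ≡ t →
      (∀ i → Q (p i)) → ∀ i → Meets u (p i) → InducedPathFrom Q u t
    go zero    p ind end q zero    m = enter zero p ind end q (λ { zero () }) m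
    go (suc k) p ind end q (suc i) m = go k (p ∘ suc) (tail-induced ind) end (q ∘ suc) i m
    go (suc k) p ind end q zero    m with any? (λ i → meets? u (p (suc i)))
    ... | yes (i , m′) = go k (p ∘ suc) (tail-induced ind) end (q ∘ suc) i m′
    ... | no far       = enter (suc k) p ind end q (λ { (suc i) _ m′ → far (i , m′) }) m

  -- Induction on the walk: its first vertex is attached to the induced path obtained from the rest,
  -- with a shortcut where possible. No new vertices arise, so `T` survives; `t` is listed
  -- separately because `T` is only known for internal vertices.
  linked⇒induced : ∀ {T : Fin n → Set} {s t} → Linked T s t → InducedPathFrom (λ x → T x ⊎ x ≡ t) s t
  linked⇒induced {T} {t = t} (edge s—t) = attach (λ x → T x ⊎ x ≡ t) 0 (λ _ → t)
    ((λ { {zero} {zero} _ → refl }) , (λ _ _ e → contradiction refl (—⇒≢ e)) , λ { zero zero () })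
    refl (λ _ → inj₂ refl) (zero , inj₂ s—t)
  linked⇒induced {T} {t = t} (via {w = w} s—w tw wt) with linked⇒induced wt
  ... | k , p , ind , refl , end , rest = attach (λ x → T x ⊎ x ≡ t) k p ind end all (zero , inj₂ s—w)
    where
    all : ∀ i → T (p i) ⊎ p i ≡ t
    all zero    = inj₁ tw
    all (suc i) = rest (suc i) (s≤s z≤n)

  linked⇒closable : ∀ {a b c s t} → Linked (¬_ ∘ InClosedNbhd G a b c) s t → Closable G a b c s t
  linked⇒closable {t = t} l with linked⇒induced l
  ... | k , p , ind , start , refl , rest = k , p , ind , start , refl , internal
    where
    internal : ∀ i → 0 < toℕ i → toℕ i < k → ¬ InClosedNbhd G _ _ _ (p i)
    internal i 0<i i<k with rest i 0<i
    ... | inj₁ ti = ti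
    -- Injectivity of the path confines `t` to index `k`, which an internal index does not reach.
    ... | inj₂ eq = contradiction (trans (cong toℕ (proj₁ ind eq)) (toℕ-fromℕ k)) (ℕ.<⇒≢ i<k)

  -- Copies in induced subgraphs

  CopyIn : Subset n → Fin n → Fin n → Fin n → Set
  CopyIn S a b c = a ∈ S × b ∈ S × c ∈ S × IsP3Copy G a b c

  copyIn? : ∀ S a b c → Dec (CopyIn S a b c)
  copyIn? S a b c = (a ∈? S) ×-dec (b ∈? S) ×-dec (c ∈? S) ×-dec isP3Copy? a b c

  copyIn-⊆ : ∀ {S S′ a b c} → S ⊆ S′ → CopyIn S a b c → CopyIn S′ a b c
  copyIn-⊆ S⊆S′ (a∈S , b∈S , c∈S , abc) = S⊆S′ a∈S , S⊆S′ b∈S , S⊆S′ c∈S , abc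

  -- Walks replace induced paths here because they can be assembled freely; `linked⇒closable`
  -- shortens them once, at the very end.
  AvoidableIn : Subset n → Fin n → Fin n → Fin n → Set
  AvoidableIn S a b c = ∀ {s t} → s ∈ S → t ∈ S → IsExtension G a b c s t →
    Linked (λ x → x ∈ S × ¬ InClosedNbhd G a b c x) s t

  HasCopyIn HasAvoidableCopyIn : Subset n → Set
  HasCopyIn          S = ∃[ a ] ∃[ b ] ∃[ c ] CopyIn S a b c
  HasAvoidableCopyIn S = ∃[ a ] ∃[ b ] ∃[ c ] CopyIn S a b c × AvoidableIn S a b c

  Near : Subset n → Fin n → Set
  Near U x = ∃ λ u → u ∈ U × Meets x u

  near? : ∀ U x → Dec (Near U x)
  near? U x = any? λ u → (u ∈? U) ×-dec meets? x u

  outside? : ∀ S U x → Dec (x ∈ S × ¬ Near U x)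
  outside? S U x = (x ∈? S) ×-dec ¬? (near? U x)

  infixl 6 _∖N[_]

  _∖N[_] : Subset n → Subset n → Subset n
  S ∖N[ U ] = comprehension (outside? S U)

  module _ {S U : Subset n} where

    ∈∖N⁺ : ∀ {x} → x ∈ S → ¬ Near U x → x ∈ S ∖N[ U ]
    ∈∖N⁺ x∈S far = ∈-comprehension⁺ (outside? S U) (x∈S , far)

    ∖N⊆ : S ∖N[ U ] ⊆ S
    ∖N⊆ = proj₁ ∘ ∈-comprehension⁻ (outside? S U)

    ∈∖N⇒¬Near : ∀ {x} → x ∈ S ∖N[ U ] → ¬ Near U x
    ∈∖N⇒¬Near = proj₂ ∘ ∈-comprehension⁻ (outside? S U)

  outside-copy : ∀ {S U a b c v} → CopyIn (S ∖N[ U ]) a b c → v ∈ U → ¬ InClosedNbhd G a b c v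
  outside-copy {S} {U} {v = v} (a∈R , b∈R , c∈R , _) v∈U =
    [ [ apart a∈R ∘ inj₁ , [ apart b∈R ∘ inj₁ , apart c∈R ∘ inj₁ ] ]
    , [ apart a∈R ∘ inj₂ , [ apart b∈R ∘ inj₂ , apart c∈R ∘ inj₂ ] ] ]
    where
    apart : ∀ {g} → g ∈ S ∖N[ U ] → ¬ Meets v g
    apart g∈R m = ∈∖N⇒¬Near g∈R (v , v∈U , Sum.map sym —-sym m)

  copyIn-∖N : ∀ {S U a b c} → CopyIn S a b c → (∀ {v} → v ∈ U → ¬ InClosedNbhd G a b c v) →
    CopyIn (S ∖N[ U ]) a b c
  copyIn-∖N (a∈S , b∈S , c∈S , abc) far =
      ∈∖N⁺ a∈S (λ { (_ , v∈U , inj₁ e) → far v∈U (inj₁ (inj₁ (sym e)))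
                  ; (_ , v∈U , inj₂ e) → far v∈U (inj₂ (inj₁ (—-sym e))) })
    , ∈∖N⁺ b∈S (λ { (_ , v∈U , inj₁ e) → far v∈U (inj₁ (inj₂ (inj₁ (sym e))))
                  ; (_ , v∈U , inj₂ e) → far v∈U (inj₂ (inj₂ (inj₁ (—-sym e)))) })
    , ∈∖N⁺ c∈S (λ { (_ , v∈U , inj₁ e) → far v∈U (inj₁ (inj₂ (inj₂ (sym e))))
                  ; (_ , v∈U , inj₂ e) → far v∈U (inj₂ (inj₂ (inj₂ (—-sym e)))) })
    , abc

  -- Boundaries and connected sets

  Boundary : Subset n → Subset n → Fin n → Set
  Boundary S U x = x ∈ S × x ∉ U × ∃ λ u → u ∈ U × x — u

  boundary? : ∀ S U x → Dec (Boundary S U x)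
  boundary? S U x = (x ∈? S) ×-dec ¬? (x ∈? U) ×-dec any? λ u → (u ∈? U) ×-dec (x —? u)

  -- U induces a connected subgraph.
  Joined : Subset n → Set
  Joined U = ∀ {u u′ w v} → u ∈ U → u′ ∈ U → w — u → u′ — v → Linked (_∈ U) w v

  joined-singleton : ∀ u → Joined ⁅ u ⁆
  joined-singleton u x∈ y∈ w—x y—v with x∈⁅y⁆⇒x≡y u x∈ | x∈⁅y⁆⇒x≡y u y∈
  ... | refl | refl = via w—x x∈ (edge y—v)

  -- A walk between `x` and an old vertex passes through `u₀`, and `x` serves as an outer neighbour
  -- of `U` when `joined` is applied.
  joined-insert : ∀ {U x u₀} → Joined U → u₀ ∈ U → x — u₀ → Joined (U ∪ ⁅ x ⁆)
  joined-insert {U} {x} joined u₀∈U x—u₀ {u} {u′} u∈ u′∈ w—u u′—v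
    with x∈p∪q⁻ U ⁅ x ⁆ u∈ | x∈p∪q⁻ U ⁅ x ⁆ u′∈
  ... | inj₁ u∈U | inj₁ u′∈U = linked-map (p⊆p∪q _) (joined u∈U u′∈U w—u u′—v)
  ... | inj₁ u∈U | inj₂ u′≡x with x∈⁅y⁆⇒x≡y x u′≡x
  ...   | refl = linked-snoc (linked-map (p⊆p∪q _) (joined u∈U u₀∈U w—u (—-sym x—u₀))) u′∈ u′—v
  joined-insert {U} {x} joined u₀∈U x—u₀ {u} {u′} u∈ u′∈ w—u u′—v | inj₂ u≡x | inj₁ u′∈U with x∈⁅y⁆⇒x≡y x u≡x
  ...   | refl = via w—u u∈ (linked-map (p⊆p∪q _) (joined u₀∈U u′∈U x—u₀ u′—v))
  joined-insert {U} {x} joined u₀∈U x—u₀ {u} {u′} u∈ u′∈ w—u u′—v | inj₂ u≡x | inj₂ u′≡x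
    with x∈⁅y⁆⇒x≡y x u≡x | x∈⁅y⁆⇒x≡y x u′≡x
  ...   | refl | refl = via w—u u∈ (edge u′—v)

  -- Lifting an avoidable copy from `R` to `S`

  module Enclosed
    (S U : Subset n) (U⊆S : U ⊆ S) (joined : Joined U)
    (touch : ∀ {x a b c} → Boundary S U x → CopyIn (S ∖N[ U ]) a b c → x — a ⊎ x — b ⊎ x — c)
    where

    R : Subset n
    R = S ∖N[ U ]

    R-far : ∀ {u x} → x ∈ R → u ∈ U → ¬ Meets x u
    R-far x∈R u∈U m = ∈∖N⇒¬Near x∈R (_ , u∈U , m)

    boundary≢ : ∀ {x g} → Boundary S U x → g ∈ R → x ≢ g
    boundary≢ (_ , _ , u , u∈U , x—u) g∈R refl = R-far g∈R u∈U (inj₂ x—u)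

    -- The remaining case, `x` in `U`, would put its neighbour `g` near `U`.
    classify : ∀ {x g} → g ∈ R → x ∈ S → x — g → x ∈ R ⊎ Boundary S U x
    classify {x} g∈R x∈S x—g with near? U x
    ... | no far                     = inj₁ (∈∖N⁺ x∈S far)
    ... | yes (_ , x∈U , inj₁ refl)  = contradiction (inj₂ (—-sym x—g)) (R-far g∈R x∈U)
    ... | yes (u , u∈U , inj₂ x—u)   =
      inj₂ (x∈S , (λ x∈U → R-far g∈R x∈U (inj₂ (—-sym x—g))) , u , u∈U , x—u)

    through-U : ∀ {x y a b c} → CopyIn R a b c → Boundary S U x → Boundary S U y →
      Linked (λ z → z ∈ S × ¬ InClosedNbhd G a b c z) x y
    through-U copy (_ , _ , u , u∈U , x—u) (_ , _ , v , v∈U , y—v) =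
      linked-map (λ z∈U → U⊆S z∈U , outside-copy copy z∈U) (joined u∈U v∈U x—u (—-sym y—v))

    -- If `s` is on the boundary, `touch` applied to `(t, b, c)` forces `t` onto the boundary too,
    -- and `U` links the two. Hence only `s` in `R` needs an argument.
    inner-extensions⇒avoidable : ∀ {a b c} → CopyIn R a b c →
      (∀ {s t} → s ∈ R → t ∈ S → IsExtension G a b c s t → Linked (λ x → x ∈ S × ¬ InClosedNbhd G a b c x) s t) →
      AvoidableIn S a b c
    inner-extensions⇒avoidable copy@(a∈R , b∈R , c∈R , (_ , _ , _ , _ , b—c , _)) inner s∈S t∈S
      ext@(_ , _ , (_ , _ , t≢c) , (s—a , s≁b , s≁c , s≁t) , (t—b , _ , t≁c))
      with classify a∈R s∈S s—a | classify b∈R t∈S t—b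
    ... | inj₁ s∈R | _        = inner s∈R t∈S ext
    ... | inj₂ ∂s  | inj₂ ∂t  = through-U copy ∂s ∂t
    ... | inj₂ ∂s  | inj₁ t∈R =
      ⊥-elim ([ s≁t , [ s≁b , s≁c ] ] (touch ∂s (t∈R , b∈R , c∈R , p3 t—b b—c t≢c t≁c)))

    -- One internal vertex is enough: a detour closes the extension, and its absence is what forces
    -- the edge `w — c` in `inner-pentagon`.
    Detour : Fin n → Fin n → Fin n → Fin n → Fin n → Set
    Detour a b c s x = ∃ λ w → w ∈ R × w — s × w — x × ¬ InClosedNbhd G a b c w

    detour? : ∀ a b c s x → Dec (Detour a b c s x)
    detour? a b c s x = any? λ w → (w ∈? R) ×-dec (w —? s) ×-dec (w —? x) ×-dec ¬? (inClosedNbhd? a b c w)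

    inner-pentagon : ∀ {a b c s x w z} → ¬ HasInducedC5 G ⊎ (∀ v → degree G v ≤ 3) →
      CopyIn R a b c → s ∈ R → Boundary S U x → IsExtension G a b c s x → ¬ Detour a b c s x →
      w ∈ R → z ∈ S → IsExtension G s a b w z → HasAvoidableCopyIn S
    inner-pentagon {a} {b} {c} {s} {x} {w} {z} hyp
      (a∈R , b∈R , c∈R , (_ , _ , a≢c , a—b , b—c , a≁c)) s∈R ∂x@(_ , _ , u , u∈U , x—u)
      (_ , (_ , s≢b , s≢c) , (x≢a , x≢b , x≢c) , (s—a , s≁b , s≁c , s≁x) , (x—b , x≁a , x≁c)) no-detour
      w∈R z∈S
      (w≢z , (w≢s , w≢a , w≢b) , (z≢s , z≢a , z≢b) , (w—s , w≁a , w≁b , w≁z) , (z—a , z≁s , z≁b))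
      = [ (λ noC5 → contradiction pentagon noC5) , subcubic ] hyp
      where
      x≁s : ¬ x — s
      x≁s = s≁x ∘ —-sym

      x—w : x — w
      -- `(w, s, a)` is a copy in `R`, and `x` is adjacent to neither `s` nor `a`.
      x—w with touch ∂x (w∈R , s∈R , a∈R , p3 w—s s—a w≢a w≁a)
      ... | inj₁ e        = e
      ... | inj₂ (inj₁ e) = contradiction e x≁s
      ... | inj₂ (inj₂ e) = contradiction e x≁a

      pentagon : HasInducedC5 G
      pentagon = x , w , s , a , b
        , (—⇒≢ x—w , boundary≢ ∂x s∈R , x≢a , x≢b , w≢s , w≢a , w≢b , —⇒≢ s—a , s≢b , —⇒≢ a—b)
        , (x—w , w—s , s—a , a—b , —-sym x—b)
        , (x≁s , x≁a , w≁a , w≁b , s≁b)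

      w—c : w — c
      -- Otherwise `w` would be a detour from `s` to `x`.
      w—c = decidable-stable (w —? c) λ w≁c → no-detour (w , w∈R , w—s , —-sym x—w ,
        [ [ w≢a , [ w≢b , (λ { refl → s≁c (—-sym w—s) }) ] ] , [ w≁a , [ w≁b , w≁c ] ] ])

      subcubic : (∀ v → degree G v ≤ 3) → HasAvoidableCopyIn S
      subcubic deg≤3 = a , s , w , copyIn-⊆ ∖N⊆ copy ,
        λ _ q∈S ext → ⊥-elim (no-extension q∈S ext)
        where
        copy : CopyIn R a s w
        copy = a∈R , s∈R , w∈R , p3 (—-sym s—a) (—-sym w—s) (w≢a ∘ sym) (w≁a ∘ —-sym)

        outside : ∀ {y g} → y ∈ U → g ∈ R → y ≢ g
        outside y∈U g∈R refl = R-far g∈R y∈U (inj₁ refl)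

        -- x already has the neighbours u, b and w.
        x-saturated : ∀ {y} → y ∈ R → x — y → y ≢ b → y ≢ w → ⊥
        x-saturated y∈R x—y y≢b y≢w = ¬four-neighbours (deg≤3 x) x—u x—b x—w x—y
          (outside u∈U b∈R) (outside u∈U w∈R) (outside u∈U y∈R)
          (w≢b ∘ sym) (y≢b ∘ sym) (y≢w ∘ sym)

        z∉R : z ∉ R
        -- For `z` in `R`, the copy `(z, a, s)` would make `z` a fourth neighbour of `x`.
        z∉R z∈R with touch ∂x (z∈R , a∈R , s∈R , p3 z—a (—-sym s—a) z≢s z≁s)
        ... | inj₁ x—z        = x-saturated z∈R x—z z≢b (w≢z ∘ sym)
        ... | inj₂ (inj₁ x—a) = x≁a x—a
        ... | inj₂ (inj₂ x—s) = x≁s x—s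

        ∂z : Boundary S U z
        ∂z = [ (λ z∈R → contradiction z∈R z∉R) , (λ ∂z → ∂z) ] (classify a∈R z∈S z—a)

        z—c : z — c
        -- As a boundary vertex, `z` has a neighbour on the copy `(b, c, w)`, and `b` and `w` are
        -- excluded.
        z—c with touch ∂z (b∈R , c∈R , w∈R , p3 b—c (—-sym w—c) (w≢b ∘ sym) (w≁b ∘ —-sym))
        ... | inj₁ z—b        = contradiction z—b z≁b
        ... | inj₂ (inj₁ e)   = e
        ... | inj₂ (inj₂ z—w) = contradiction (—-sym z—w) w≁z

        -- A further neighbour `q` of `s` overloads some vertex. In `R`, the copy `(q, s, a)` makes
        -- `q` a fourth neighbour of `x`. On the boundary, `q` has a neighbour on `(a, b, c)`:
        -- either `b`, already adjacent to `a`, `c`, `x`, or `c`, already adjacent to `b`, `w`, `z`.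
        no-extension : ∀ {p q} → q ∈ S → ¬ IsExtension G a s w p q
        no-extension {q = q} q∈S (_ , _ , (q≢a , _ , q≢w) , _ , (q—s , q≁a , q≁w))
          with classify s∈R q∈S q—s
        ... | inj₁ q∈R with touch ∂x (q∈R , s∈R , a∈R , p3 q—s s—a q≢a q≁a)
        ...   | inj₁ x—q        = x-saturated q∈R x—q (separated q—s (s≁b ∘ —-sym)) q≢w
        ...   | inj₂ (inj₁ x—s) = x≁s x—s
        ...   | inj₂ (inj₂ x—a) = x≁a x—a
        no-extension {q = q} q∈S (_ , _ , _ , _ , (q—s , q≁a , q≁w)) | inj₂ ∂q
          with touch ∂q (a∈R , b∈R , c∈R , p3 a—b b—c a≢c a≁c)
        ...   | inj₁ q—a        = q≁a q—a
        ...   | inj₂ (inj₁ q—b) = ¬four-neighbours (deg≤3 b) (—-sym a—b) b—c (—-sym x—b) (—-sym q—b)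
          a≢c (x≢a ∘ sym) (boundary≢ ∂q a∈R ∘ sym) (x≢c ∘ sym) (boundary≢ ∂q c∈R ∘ sym)
          (separated q—s x≁s ∘ sym)
        ...   | inj₂ (inj₂ q—c) = ¬four-neighbours (deg≤3 c) (—-sym b—c) (—-sym w—c) (—-sym z—c) (—-sym q—c)
          (w≢b ∘ sym) (z≢b ∘ sym) (boundary≢ ∂q b∈R ∘ sym) w≢z (boundary≢ ∂q w∈R ∘ sym)
          (separated q—s z≁s ∘ sym)

    lift-avoidable : ¬ HasInducedC5 G ⊎ (∀ v → degree G v ≤ 3) → HasAvoidableCopyIn R → HasAvoidableCopyIn S
    lift-avoidable hyp (a , b , c , copy@(a∈R , b∈R , _ , (_ , _ , _ , a—b , _)) , avoidable)
      -- The search is for an extension that neither avoidability in `R` nor a detour closes.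
      with any? (λ s → any? λ x →
        (s ∈? R) ×-dec boundary? S U x ×-dec isExtension? a b c s x ×-dec ¬? (detour? a b c s x))
    ... | no ¬blocked = a , b , c , copyIn-⊆ ∖N⊆ copy , inner-extensions⇒avoidable copy inner
      where
      inner : ∀ {s t} → s ∈ R → t ∈ S → IsExtension G a b c s t →
        Linked (λ x → x ∈ S × ¬ InClosedNbhd G a b c x) s t
      inner {s} {t} s∈R t∈S ext@(_ , _ , _ , _ , (t—b , _)) with classify b∈R t∈S t—b
      ... | inj₁ t∈R = linked-map (λ { (x∈R , far) → ∖N⊆ x∈R , far }) (avoidable s∈R t∈R ext)
      ... | inj₂ ∂t with detour? a b c s t
      ...   | yes (w , w∈R , w—s , w—t , far) = via (—-sym w—s) (∖N⊆ w∈R , far) (edge w—t)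
      ...   | no ¬detour = contradiction (s , t , s∈R , ∂t , ext , ¬detour) ¬blocked
    ... | yes (s , x , s∈R , ∂x , ext@(_ , (_ , s≢b , _) , _ , (s—a , s≁b , _) , _) , ¬detour)
      with any? (λ w → any? λ z → (w ∈? R) ×-dec (z ∈? S) ×-dec isExtension? s a b w z)
    ...   | yes (w , z , w∈R , z∈S , ext′) = inner-pentagon hyp copy s∈R ∂x ext ¬detour w∈R z∈S ext′
    -- `(s, a, b)` has no extension whose first new vertex lies in `R`, so the inner condition holds
    -- vacuously.
    ...   | no ¬ext = s , a , b , copyIn-⊆ ∖N⊆ copy′ , inner-extensions⇒avoidable copy′
      λ w∈R z∈S ext′ → contradiction (_ , _ , w∈R , z∈S , ext′) ¬ext
      where
      copy′ : CopyIn R s a b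
      copy′ = s∈R , a∈R , b∈R , p3 s—a a—b s≢b s≁b

  -- The two nested inductions: shrinking `S` and growing `U`

  module _ (hyp : ¬ HasInducedC5 G ⊎ (∀ v → degree G v ≤ 3)) where

    -- Recursion on growing `U`. A boundary vertex that misses some copy in `R` is absorbed, and
    -- that very copy stays outside the enlarged neighbourhood; when no such vertex is left, `touch`
    -- holds and `ih` applies to `R`, which has lost `u₀`.
    enclose : ∀ S → (∀ {S′} → S′ ⊂ S → HasCopyIn S′ → HasAvoidableCopyIn S′) →
      ∀ U → Acc _⊃_ U → U ⊆ S → Joined U → ∃ (_∈ U) → HasCopyIn (S ∖N[ U ]) → HasAvoidableCopyIn S
    enclose S ih U (acc larger) U⊆S joined (u₀ , u₀∈U) copy
      with any? (λ x → any? λ a → any? λ b → any? λ c →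
        boundary? S U x ×-dec copyIn? (S ∖N[ U ]) a b c ×-dec ¬? (inClosedNbhd? a b c x))
    ... | yes (x , a , b , c , (x∈S , x∉U , u , u∈U , x—u) , copy′ , far) =
      enclose S ih (U ∪ ⁅ x ⁆) (larger (p⊆p∪q _ , x , x∈p∪q⁺ (inj₂ (x∈⁅x⁆ x)) , x∉U)) U+x⊆S
        (joined-insert joined u∈U x—u) (u₀ , p⊆p∪q _ u₀∈U)
        (a , b , c , copyIn-∖N (copyIn-⊆ ∖N⊆ copy′) U+x-far)
      where
      U+x⊆S : U ∪ ⁅ x ⁆ ⊆ S
      U+x⊆S y∈ = [ U⊆S , (λ y∈x → subst (_∈ S) (sym (x∈⁅y⁆⇒x≡y x y∈x)) x∈S) ] (x∈p∪q⁻ U ⁅ x ⁆ y∈)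

      U+x-far : ∀ {v} → v ∈ U ∪ ⁅ x ⁆ → ¬ InClosedNbhd G a b c v
      U+x-far v∈ with x∈p∪q⁻ U ⁅ x ⁆ v∈
      ... | inj₁ v∈U = outside-copy copy′ v∈U
      ... | inj₂ v∈x with x∈⁅y⁆⇒x≡y x v∈x
      ...   | refl = far
    ... | no ¬untouched = Enclosed.lift-avoidable S U U⊆S joined touch hyp (ih R⊂S copy)
      where
      R⊂S : S ∖N[ U ] ⊂ S
      R⊂S = ∖N⊆ , u₀ , U⊆S u₀∈U , λ u₀∈R → ∈∖N⇒¬Near u₀∈R (u₀ , u₀∈U , inj₁ refl)

      touch : ∀ {x a b c} → Boundary S U x → CopyIn (S ∖N[ U ]) a b c → x — a ⊎ x — b ⊎ x — c
      touch {x} {a} {b} {c} ∂x@(_ , _ , u , u∈U , x—u) copy@(a∈R , b∈R , c∈R , _)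
        with decidable-stable (inClosedNbhd? a b c x) (λ far → ¬untouched (x , a , b , c , ∂x , copy , far))
      ... | inj₂ adjacent           = adjacent
      -- The closed neighbourhood also allows `x` to lie on the copy, but `x` is near `U` and the
      -- copy is not.
      ... | inj₁ (inj₁ refl)        = contradiction (u , u∈U , inj₂ x—u) (∈∖N⇒¬Near a∈R)
      ... | inj₁ (inj₂ (inj₁ refl)) = contradiction (u , u∈U , inj₂ x—u) (∈∖N⇒¬Near b∈R)
      ... | inj₁ (inj₂ (inj₂ refl)) = contradiction (u , u∈U , inj₂ x—u) (∈∖N⇒¬Near c∈R)

    has-avoidable : ∀ S → Acc _⊂_ S → HasCopyIn S → HasAvoidableCopyIn S
    has-avoidable S (acc smaller) (a , b , c , copy@(_ , b∈S , c∈S , (_ , _ , _ , _ , b—c , _)))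
      with any? (λ u → any? λ a → any? λ b → any? λ c →
        (u ∈? S) ×-dec copyIn? S a b c ×-dec ¬? (inClosedNbhd? a b c u))
    -- Any extension would place `s` outside the closed neighbourhood of the copy `(t, b, c)`, so
    -- the given copy has none.
    ... | no ¬far = a , b , c , copy , λ
      { s∈S t∈S (s≢t , (_ , s≢b , s≢c) , (_ , _ , t≢c) , (_ , s≁b , s≁c , s≁t) , (t—b , _ , t≁c)) →
        contradiction (_ , _ , _ , _ , s∈S , (t∈S , b∈S , c∈S , p3 t—b b—c t≢c t≁c) ,
          [ [ s≢t , [ s≢b , s≢c ] ] , [ s≁t , [ s≁b , s≁c ] ] ]) ¬far }
    ... | yes (u , a′ , b′ , c′ , u∈S , copy′ , far) =
      enclose S (λ S′⊂S → has-avoidable _ (smaller S′⊂S)) ⁅ u ⁆ (⊃-wellFounded _)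
        (λ y∈ → subst (_∈ S) (sym (x∈⁅y⁆⇒x≡y u y∈)) u∈S) (joined-singleton u) (u , x∈⁅x⁆ u)
        (a′ , b′ , c′ , copyIn-∖N copy′ (λ v∈ → subst (¬_ ∘ InClosedNbhd G a′ b′ c′) (sym (x∈⁅y⁆⇒x≡y u v∈)) far))

theorem1p10 : (G : Graph) →
    (Σ (V G) λ a → Σ (V G) λ b → Σ (V G) λ c → IsP3Copy G a b c) →
    (¬ HasInducedC5 G ⊎ (∀ x → degree G x ≤ 3)) →
    Σ (V G) λ a → Σ (V G) λ b → Σ (V G) λ c → IsP3Copy G a b c × Avoidable G a b c
theorem1p10 G (a , b , c , abc) hyp with has-avoidable G hyp ⊤ (⊂-wellFounded ⊤) (a , b , c , ∈⊤ , ∈⊤ , ∈⊤ , abc)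
... | a′ , b′ , c′ , (_ , _ , _ , copy) , avoidable =
  a′ , b′ , c′ , copy , λ s t ext → linked⇒closable G (linked-map G proj₂ (avoidable ∈⊤ ∈⊤ ext))
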